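{- Let $A$ be a finite alphabet and $L\subseteq H_A$ a regular forest language with syntactic forest algebra $(H_L,V_L)$. If $L$ is locally testable, then $L$ is $(|H_L|^2+1)$-locally testable.
   Context: Forest algebras. A forest algebra $(H,V)$ consists of a commutative monoid $H$ (additive, identity $0$), a monoid $V$, and a faithful right action $H\times V\to H$ such that for $v\in V$, $h\in H$ there is $v+h\in V$ with $g(v+h)=gv+h$ for all $g\in H$; homomorphisms are pairs of monoid homomorphisms compatible with the action. Free forest algebra. $A^{\Delta}=(H_A,V_A)$: $H_A$ is the set of finite forests (finite multisets of finite rooted trees, unordered children) with nodes labeled by letters of $A$, with $+$ disjoint union and $0$ the empty forest; $V_A$ is the set of contexts (forests with exactly one leaf replaced by a hole); $sp$ substitutes forest $s$ into the hole of $p$, $pq$ substitutes $p$ into the hole of $q$. A forest language $L\subseteq H_A$ is regular if $L=\alpha^{ -1}(X)$ for some homomorphism $\alpha$ into a finite forest algebra and some $X$. Its syntactic forest algebra $(H_L,V_L)$ is the quotient of $A^{\Delta}$ by the syntactic congruence ($s\approx t$ iff for all $p\in V_A$, $sp\in L\Leftrightarrow tp\in L$; $p\approx q$ iff $sp\approx sq$ for all $s\in H_A$); it is finite and divides every forest algebra recognizing $L$. Definite types and local testability. All nodes have the same $0$-definite type; for $k>0$ the $k$-definite type of a node is $(a,T)$ with $a$ its label and $T$ the set of $(k-1)$-definite types of its children. For $k>0$, $s\equiv_k t$ iff the sets of $(k-1)$-definite types of the roots of $s$ and $t$ coincide and the sets of $k$-definite types of all nodes of $s$ and $t$ coincide.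 $L$ is $k$-locally testable if it is a union of $\equiv_k$-classes, and locally testable if it is $k$-locally testable for some $k$. -}

module Defs where

open import Data.Nat using (ℕ; zero; suc)
open import Data.Fin using (Fin)
open import Data.List using (List; []; _∷_; _++_)
open import Data.List.Relation.Unary.Any using (Any)
open import Data.List.Membership.Propositional using (_∈_)
open import Data.Product using (Σ; _×_)
open import Data.Unit using (⊤)
open import Data.Empty using (⊥)
open import Function.Bundles using (_⇔_; _↔_)
open import Relation.Binary.PropositionalEquality using (_≡_)

-- Finite forests over an alphabet A (free forest algebra, by representatives).
-- A forest is represented by a list of trees; the order of the list
-- (and of children) is irrelevant in the paper (multisets).  All notions
-- below (regular languages via homomorphisms into commutative H,
-- definite types) are insensitive to this order.

data Tree (A : Set) : Set where
  node : A → List (Tree A) → Tree A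

Forest : Set → Set
Forest A = List (Tree A)

-- Contexts: forests with exactly one leaf replaced by a hole.
--   hole      : the context consisting of the hole only
--   add t p   : the context  t + p
--   wrap a p  : the context  a(p)  (a node labelled a whose children form p)
data Ctx (A : Set) : Set where
  hole : Ctx A
  add  : Tree A → Ctx A → Ctx A
  wrap : A → Ctx A → Ctx A

fill : {A : Set} → Ctx A → Forest A → Forest A
fill hole       s = s
fill (add t p)  s = t ∷ fill p s
fill (wrap a p) s = node a (fill p s) ∷ []

-- plugCtx q p : substitute the context p into the hole of q.
-- The product  p q  of V_A (p substituted into the hole of q) is  plugCtx q p.
plugCtx : {A : Set} → Ctx A → Ctx A → Ctx A
plugCtx hole       p = p
plugCtx (add t q)  p = add t (plugCtx q p)
plugCtx (wrap a q) p = wrap a (plugCtx q p)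

record ForestAlgebra : Set₁ where
  field
    H V   : Set
    _⊕_   : H → H → H
    𝟘     : H
    _∙_   : V → V → V
    𝟙     : V
    _·_   : H → V → H
    ⊕-assoc     : ∀ x y z → (x ⊕ y) ⊕ z ≡ x ⊕ (y ⊕ z)
    ⊕-comm      : ∀ x y → x ⊕ y ≡ y ⊕ x
    ⊕-identityˡ : ∀ x → 𝟘 ⊕ x ≡ x
    ⊕-identityʳ : ∀ x → x ⊕ 𝟘 ≡ x
    ∙-assoc     : ∀ u v w → (u ∙ v) ∙ w ≡ u ∙ (v ∙ w)
    ∙-identityˡ : ∀ v → 𝟙 ∙ v ≡ v
    ∙-identityʳ : ∀ v → v ∙ 𝟙 ≡ v
    act-𝟙       : ∀ h → h · 𝟙 ≡ h
    act-∙       : ∀ h v w → h · (v ∙ w) ≡ (h · v) · w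
    faithful    : ∀ v w → (∀ h → h · v ≡ h · w) → v ≡ w
    insertion   : ∀ (v : V) (h : H) → Σ V (λ u → ∀ g → g · u ≡ (g · v) ⊕ h)

record Finite (X : Set) : Set where
  field
    size  : ℕ
    enum  : X ↔ Fin size

record Hom (A : Set) (F : ForestAlgebra) : Set where
  open ForestAlgebra F
  field
    αH : Forest A → H
    αV : Ctx A → V
    αH-𝟘   : αH [] ≡ 𝟘
    αH-⊕   : ∀ s t → αH (s ++ t) ≡ αH s ⊕ αH t
    αV-𝟙   : αV hole ≡ 𝟙
    αV-∙   : ∀ p q → αV (plugCtx q p) ≡ αV p ∙ αV q
    αH-act : ∀ s p → αH (fill p s) ≡ αH s · αV p

Regular : {A : Set} → (Forest A → Set) → Set₁
Regular {A} L =
  Σ ForestAlgebra λ F →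
    Finite (ForestAlgebra.H F) × Finite (ForestAlgebra.V F) ×
    Σ (Hom A F) λ α → Σ (ForestAlgebra.H F → Set) λ X →
      ∀ s → L s ⇔ X (Hom.αH α s)

SynEq : {A : Set} → (Forest A → Set) → Forest A → Forest A → Set
SynEq L s t = ∀ p → L (fill p s) ⇔ L (fill p t)

-- H_L (the set of syntactic classes of forests) has exactly n elements:
-- a system of n pairwise inequivalent representatives covering all classes.
SyntacticHSize : {A : Set} → (Forest A → Set) → ℕ → Set
SyntacticHSize {A} L n =
  Σ (Fin n → Forest A) λ r →
    (∀ i j → SynEq L (r i) (r j) → i ≡ j) ×
    (∀ s → Σ (Fin n) λ i → SynEq L s (r i))

-- Definite types (a node is identified with the subtree rooted at it)

SameType : {A : Set} → ℕ → Tree A → Tree A → Set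
SameType zero    _          _          = ⊤
SameType (suc k) (node a f) (node b g) =
  a ≡ b ×
  (∀ t → t ∈ f → Any (SameType k t) g) ×
  (∀ u → u ∈ g → Any (SameType k u) f)

SameTypeSets : {A : Set} → ℕ → List (Tree A) → List (Tree A) → Set
SameTypeSets k l m =
  (∀ t → t ∈ l → Any (SameType k t) m) ×
  (∀ u → u ∈ m → Any (SameType k u) l)

mutual
  nodesT : {A : Set} → Tree A → List (Tree A)
  nodesT (node a f) = node a f ∷ nodesF f

  nodesF : {A : Set} → Forest A → List (Tree A)
  nodesF []      = []
  nodesF (t ∷ f) = nodesT t ++ nodesF f

-- EquivSuc k s t  is  s ≡_{k+1} t
EquivSuc : {A : Set} → ℕ → Forest A → Forest A → Set
EquivSuc k s t = SameTypeSets k s t × SameTypeSets (suc k) (nodesF s) (nodesF t)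

-- k-local testability (only defined for k > 0 in the paper; k = 0 gives ⊥)
KLocallyTestable : {A : Set} → ℕ → (Forest A → Set) → Set
KLocallyTestable zero    L = ⊥
KLocallyTestable (suc k) L = ∀ s t → EquivSuc k s t → L s → L t

LocallyTestable : {A : Set} → (Forest A → Set) → Set
LocallyTestable L = Σ ℕ λ k → KLocallyTestable k L

{-# OPTIONS --safe #-}

-- Write f ≈[ e ] g when f and g are interchangeable, in every context, beside a
-- top-level copy of the forest e.  Everything rests on a copying rule: if a
-- node z of e has the same n²-definite type as x, then x ≈[ e ] x + z.  For types
-- of the depth K that is given by local testability this is immediate, and it
-- only involves the syntactic values of x and z.  The set of pairs of values of
-- trees of equal k-type decreases with k inside H_L × H_L, and it is constant
-- from the first repetition on; hence it is the same for all k ≥ n².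
--
-- Copying gives absorption: x ≈[ e ] x + y whenever x and y have the same n²-type
-- and every (n²+1)-type of y occurs in e.  By induction on y = a(c), take a
-- node a(d) of e of the same type: its children absorb c, so e may be assumed
-- to contain a(d + c) too.  Copying it next to x, and then deleting d (again by
-- copying, as d and c have the same types), yields x ≈ x + a(d + c) ≈ x + a(c).
-- If s and t are equivalent, absorption identifies both with s + t.
module Submission where

open import Defs
open import Data.Nat using (ℕ; zero; suc; _+_; _*_; _≤_; _<_; _≤′_; ≤′-refl; ≤′-step)
open import Data.Nat.Properties using (≤-refl; ≤⇒≤′; m≤m+n; n<1+n)
open import Data.Fin using (Fin; toℕ; combine)
open import Data.Fin.Properties
  using (any?; all?; ¬∀⟶∃¬; pigeonhole; sequence; combine-injective; toℕ≤pred[n])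
  renaming (_≟_ to _≟ᶠ_)
open import Data.List using (List; []; _∷_; _++_; [_])
open import Data.List.Properties using (++-assoc; ++-identityʳ)
open import Data.List.Membership.Propositional using (_∈_; find; lose)
open import Data.List.Membership.Propositional.Properties using (∈-++⁺ˡ; ∈-++⁺ʳ; ∈-++⁻)
open import Data.List.Relation.Binary.Subset.Propositional using (_⊆_)
open import Data.List.Relation.Binary.Subset.Propositional.Properties
  using (Any-resp-⊆; xs⊆xs++ys; xs⊆ys++xs; ++⁺; ∈-∷⁺ʳ)
open import Data.List.Relation.Unary.Any as Any using (Any; here; there)
open import Data.List.Relation.Unary.All as All using (All; []; _∷_)
open import Data.Product using (∃; ∃₂; _×_; _,_; proj₁; proj₂; swap)
open import Data.Sum using (inj₁; inj₂; [_,_]′)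
open import Data.Unit using (tt)
open import Effect.Monad using (module RawMonad)
open import Function using (_∘_; id)
open import Function.Bundles using (_⇔_; mk⇔; Equivalence)
import Function.Properties.Equivalence as ⇔
open import Relation.Nullary using (¬_; Dec; yes; no; contradiction)
open import Relation.Nullary.Decidable using (decidable-stable; ¬¬-excluded-middle)
open import Relation.Nullary.Negation using (¬¬-map; ¬¬-Monad)
open import Relation.Binary.PropositionalEquality
  using (_≡_; refl; sym; trans; cong; subst; subst₂)

-- Decreasing chains of subsets of a finite set.

-- If each of the `suc m` steps lost an element, two of them would lose the same one by pigeonhole;
-- but a lost element never returns.
antitone-chain-stabilises :
  ∀ m (R : ℕ → Fin m → Set) → (∀ {j k} → j ≤ k → ∀ {c} → R k c → R j c) →
  ¬ ¬ (∃ λ k → k ≤ m × (∀ c → R k c → R (suc k) c))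
antitone-chain-stabilises m R antitone =
  -- `R` need not be decidable; the finitely many instances of excluded middle that are required are
  -- collected under double negation.
  ¬¬-map fromDec (sequence app λ k → sequence app λ c → ¬¬-excluded-middle)
  where
  app = RawMonad.rawApplicative ¬¬-Monad

  Persists : Fin (suc m) → Fin m → Set
  Persists k c = R (toℕ k) c → R (suc (toℕ k)) c

  module _ (persists? : ∀ k c → Dec (Persists k c)) (¬stable : ¬ ∃ λ k → ∀ c → Persists k c) where
    lost : ∀ k → ∃ λ c → ¬ Persists k c
    lost k = ¬∀⟶∃¬ m (Persists k) (persists? k) (λ stable → ¬stable (k , stable))

    lost-twice : ∀ {i j c} → toℕ i < toℕ j → ¬ Persists i c → ¬ ¬ Persists j c
    lost-twice i<j ¬pᵢ ¬pⱼ = ¬pⱼ λ r → contradiction (λ _ → antitone i<j r) ¬pᵢ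

  fromDec : (∀ k c → Dec (Persists k c)) → ∃ λ k → k ≤ m × (∀ c → R k c → R (suc k) c)
  fromDec persists? with any? (λ k → all? (persists? k))
  ... | yes (k , stable) = toℕ k , toℕ≤pred[n] k , stable
  ... | no ¬stable with pigeonhole (n<1+n m) (proj₁ ∘ lost persists? ¬stable)
  ...   | i , j , i<j , cᵢ≡cⱼ =
    contradiction
      (subst (λ c → ¬ Persists j c) (sym cᵢ≡cⱼ) (proj₂ (lost persists? ¬stable j)))
      (lost-twice persists? ¬stable i<j (proj₂ (lost persists? ¬stable i)))

++-least : {X : Set} {xs ys zs : List X} → xs ⊆ zs → ys ⊆ zs → xs ++ ys ⊆ zs
++-least {xs = xs} f g = [ f , g ]′ ∘ ∈-++⁻ xs

-- Definite types, nodes and contexts.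

module _ {A : Set} where

  private variable
    f g h l m : Forest A

  Covers : ℕ → List (Tree A) → List (Tree A) → Set
  Covers k l m = ∀ t → t ∈ l → Any (SameType k t) m

  SameType-refl : ∀ k (t : Tree A) → SameType k t t
  Covers-⊆      : ∀ k → l ⊆ m → Covers k l m
  SameType-refl zero    t          = tt
  SameType-refl (suc k) (node a f) = refl , Covers-⊆ k id , Covers-⊆ k id
  Covers-⊆ k l⊆m t t∈l = lose (l⊆m t∈l) (SameType-refl k t)

  SameType-sym : ∀ k (t u : Tree A) → SameType k t u → SameType k u t
  SameType-sym zero    t          u          _            = tt
  SameType-sym (suc k) (node a f) (node b g) (eq , p , q) = sym eq , q , p

  SameType-trans : ∀ k (t u v : Tree A) → SameType k t u → SameType k u v → SameType k t v
  Covers-trans   : ∀ k → Covers k f g → Covers k g h → Covers k f h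
  SameType-trans zero    t u v _ _ = tt
  SameType-trans (suc k) (node a f) (node b g) (node c h) (p , p₁ , p₂) (q , q₁ , q₂) =
    trans p q , Covers-trans k p₁ q₁ , Covers-trans k q₂ p₂
  Covers-trans k p q t t∈f with find (p t t∈f)
  ... | u , u∈g , t~u = Any.map (λ {v} → SameType-trans k t u v t~u) (q u u∈g)

  Covers-++ : ∀ k → Covers k f h → Covers k g h → Covers k (f ++ g) h
  Covers-++ {f = f} k p q t t∈f++g = [ p t , q t ]′ (∈-++⁻ f t∈f++g)

  Covers-[] : ∀ k (t u : Tree A) → SameType k t u → Covers k [ t ] [ u ]
  Covers-[] k t u t~u .t (here refl) = here t~u

  SameTypeSets-++ : ∀ k → SameTypeSets k f g → SameTypeSets k h l → SameTypeSets k (f ++ h) (g ++ l)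
  SameTypeSets-++ {f} {g} {h} {l} k (p , p′) (q , q′) =
    Covers-++ k (Covers-trans k p (Covers-⊆ {g} k (xs⊆xs++ys g l)))
                (Covers-trans k q (Covers-⊆ k (xs⊆ys++xs l g))) ,
    Covers-++ k (Covers-trans k p′ (Covers-⊆ k (xs⊆xs++ys f h)))
                (Covers-trans k q′ (Covers-⊆ k (xs⊆ys++xs h f)))

  SameTypeSets-[] : ∀ k (t u : Tree A) → SameType k t u → SameTypeSets k [ t ] [ u ]
  SameTypeSets-[] k t u t~u = Covers-[] k t u t~u , Covers-[] k u t (SameType-sym k t u t~u)

  SameType-pred : ∀ k (t u : Tree A) → SameType (suc k) t u → SameType k t u
  Covers-pred   : ∀ k → Covers (suc k) f g → Covers k f g
  SameType-pred zero    t          u          _            = tt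
  SameType-pred (suc k) (node a f) (node b g) (eq , p , q) = eq , Covers-pred k p , Covers-pred k q
  Covers-pred k p t t∈f = Any.map (λ {u} → SameType-pred k t u) (p t t∈f)

  SameType-≤′ : ∀ {j k} → j ≤′ k → ∀ (t u : Tree A) → SameType k t u → SameType j t u
  SameType-≤′             ≤′-refl       t u t~u = t~u
  SameType-≤′ {k = suc k} (≤′-step j≤k) t u t~u = SameType-≤′ j≤k t u (SameType-pred k t u t~u)

  SameType-≤ : ∀ {j k} → j ≤ k → ∀ (t u : Tree A) → SameType k t u → SameType j t u
  SameType-≤ = SameType-≤′ ∘ ≤⇒≤′

  ∈-nodesF⁺ : ∀ {t} → Any (λ u → t ∈ nodesT u) f → t ∈ nodesF f
  ∈-nodesF⁺ (here  p)           = ∈-++⁺ˡ p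
  ∈-nodesF⁺ (there {x = u} p) = ∈-++⁺ʳ (nodesT u) (∈-nodesF⁺ p)

  ∈-nodesF⁻ : ∀ (f : Forest A) {t} → t ∈ nodesF f → Any (λ u → t ∈ nodesT u) f
  ∈-nodesF⁻ (u ∷ f) = [ here , there ∘ ∈-nodesF⁻ f ]′ ∘ ∈-++⁻ (nodesT u)

  nodesF-mono : f ⊆ g → nodesF f ⊆ nodesF g
  nodesF-mono {f} f⊆g = ∈-nodesF⁺ ∘ Any-resp-⊆ f⊆g ∘ ∈-nodesF⁻ f

  nodesF-++ : ∀ (f g : Forest A) → nodesF (f ++ g) ≡ nodesF f ++ nodesF g
  nodesF-++ []      g = refl
  nodesF-++ (t ∷ f) g =
    trans (cong (nodesT t ++_) (nodesF-++ f g)) (sym (++-assoc (nodesT t) (nodesF f) (nodesF g)))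

  ⊆-nodesF : f ⊆ nodesF f
  ⊆-nodesF {node a g ∷ f} (here refl) = here refl
  ⊆-nodesF {node a g ∷ f} (there t∈f) = there (∈-++⁺ʳ (nodesF g) (⊆-nodesF t∈f))

  nodesT-children : ∀ (t : Tree A) {a d} → node a d ∈ nodesT t → d ⊆ nodesT t
  nodesF-children : ∀ (f : Forest A) {a d} → node a d ∈ nodesF f → d ⊆ nodesF f
  nodesT-children (node b g) (here refl) = there ∘ ⊆-nodesF
  nodesT-children (node b g) (there p)   = there ∘ nodesF-children g p
  nodesF-children (t ∷ f) p with ∈-++⁻ (nodesT t) p
  ... | inj₁ q = ∈-++⁺ˡ ∘ nodesT-children t q
  ... | inj₂ q = ∈-++⁺ʳ (nodesT t) ∘ nodesF-children f q

  nodesF-⊆-fill : ∀ p → nodesF f ⊆ nodesF (fill p f)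
  nodesF-⊆-fill hole       = id
  nodesF-⊆-fill (add t p)  = ∈-++⁺ʳ (nodesT t) ∘ nodesF-⊆-fill p
  nodesF-⊆-fill (wrap a p) = there ∘ ∈-++⁺ˡ ∘ nodesF-⊆-fill p

  fill-plugCtx : ∀ p q (f : Forest A) → fill (plugCtx p q) f ≡ fill p (fill q f)
  fill-plugCtx hole       q f = refl
  fill-plugCtx (add t p)  q f = cong (t ∷_) (fill-plugCtx p q f)
  fill-plugCtx (wrap a p) q f = cong (λ h → [ node a h ]) (fill-plugCtx p q f)

  addAll : Forest A → Ctx A → Ctx A
  addAll []      p = p
  addAll (t ∷ e) p = add t (addAll e p)

  fill-addAll : ∀ e p f → fill (addAll e p) f ≡ e ++ fill p f
  fill-addAll []      p f = refl
  fill-addAll (t ∷ e) p f = cong (t ∷_) (fill-addAll e p f)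

  fill-SameTypeSets : ∀ k p → SameTypeSets k f g → SameTypeSets k (fill p f) (fill p g)
  fill-SameTypeSets k hole       f~g = f~g
  fill-SameTypeSets k (add t p)  f~g =
    SameTypeSets-++ k (SameTypeSets-[] k t t (SameType-refl k t)) (fill-SameTypeSets k p f~g)
  fill-SameTypeSets k (wrap a p) f~g =
    SameTypeSets-[] k (node a (fill p _)) (node a (fill p _))
      (SameType-pred k (node a (fill p _)) (node a (fill p _)) (refl , fill-SameTypeSets k p f~g))

  -- Only the ancestors of the hole change, and they keep their `suc k`-types because their children
  -- keep the same set of `k`-types. The list `e` may supply types that `g` lacks.
  fill-Covers : ∀ k e p → SameTypeSets k f g →
    Covers (suc k) (nodesF f) (e ++ nodesF g) →
    Covers (suc k) (nodesF (fill p f)) (e ++ nodesF (fill p g))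
  fill-Covers k e hole      f~g cov = cov
  fill-Covers k e (add t p) f~g cov =
    Covers-++ {nodesT t} (suc k) (Covers-⊆ (suc k) (∈-++⁺ʳ e ∘ ∈-++⁺ˡ))
      (Covers-trans (suc k) (fill-Covers k e p f~g cov)
        (Covers-⊆ (suc k) (++⁺ {ws = e} id (xs⊆ys++xs _ (nodesT t)))))
  fill-Covers {f} {g} k e (wrap a p) f~g cov =
    Covers-++ {[ node a (fill p f) ]} (suc k)
      (Covers-trans (suc k)
        (Covers-[] (suc k) (node a (fill p f)) (node a (fill p g)) (refl , fill-SameTypeSets k p f~g))
        (Covers-⊆ (suc k) λ { (here refl) → ∈-++⁺ʳ e (here refl) }))
      (Covers-trans (suc k)
        (subst (λ l → Covers (suc k) l (e ++ nodesF (fill p g))) (sym (++-identityʳ _))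
          (fill-Covers k e p f~g cov))
        (Covers-⊆ (suc k) (++⁺ {ws = e} id (there ∘ ∈-++⁺ˡ))))

-- Interchangeability beside a forest.

module _ {A : Set} (L : Forest A → Set) where

  infix 4 _≈[_]_ _~_

  -- The copy of `e` stays outside `p`, so its nodes keep their types whatever the context, and the
  -- relation is closed under contexts.
  record _≈[_]_ (f e g : Forest A) : Set where
    constructor interchangeable
    field
      inContext : ∀ p → L (e ++ fill p f) ⇔ L (e ++ fill p g)

  open _≈[_]_

  _~_ : Forest A → Forest A → Set
  f ~ g = f ≈[ [] ] g

  private variable
    e e′ f f′ g g′ h h′ : Forest A

  ≈-refl : f ≈[ e ] f
  ≈-refl .inContext p = ⇔.refl

  ≈-sym : f ≈[ e ] g → g ≈[ e ] f
  ≈-sym f≈g .inContext p = ⇔.sym (inContext f≈g p)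

  infixr 5 _⨾_

  _⨾_ : f ≈[ e ] g → g ≈[ e ] h → f ≈[ e ] h
  (f≈g ⨾ g≈h) .inContext p = ⇔.trans (inContext f≈g p) (inContext g≈h p)

  ≈-fill : ∀ q → f ≈[ e ] g → fill q f ≈[ e ] fill q g
  ≈-fill {f} {e} {g} q f≈g .inContext p =
    subst₂ (λ u v → L (e ++ u) ⇔ L (e ++ v)) (fill-plugCtx p q f) (fill-plugCtx p q g)
      (inContext f≈g (plugCtx p q))

  ≈-++ : ∀ h → f ≈[ e ] g → h ++ f ≈[ e ] h ++ g
  ≈-++ {f} {e} {g} h f≈g =
    subst₂ (_≈[ e ]_) (fill-addAll h hole f) (fill-addAll h hole g) (≈-fill (addAll h hole) f≈g)

  ~⇒≈ : f ~ g → f ≈[ e ] g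
  ~⇒≈ {f} {g} {e} f~g .inContext p =
    subst₂ (λ u v → L u ⇔ L v) (fill-addAll e p f) (fill-addAll e p g) (inContext f~g (addAll e p))

  ≈-env : (∀ h → L (e ++ h) ⇔ L (e′ ++ h)) → f ≈[ e′ ] g → f ≈[ e ] g
  ≈-env e⇔e′ f≈g .inContext p = ⇔.trans (e⇔e′ _) (⇔.trans (inContext f≈g p) (⇔.sym (e⇔e′ _)))

  -- Inclusion between the sets of pairs of syntactic values realised by trees of equal type, at
  -- depth `j` and at depth `k`.
  Pump : ℕ → ℕ → Set
  Pump j k = ∀ x z → SameType j x z →
    ∃₂ λ x′ z′ → SameType k x′ z′ × ([ x ] ~ [ x′ ]) × ([ z ] ~ [ z′ ])

  Pump-trans : ∀ {i j k} → Pump i j → Pump j k → Pump i k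
  Pump-trans i⇒j j⇒k x z x≡z with i⇒j x z x≡z
  ... | x₁ , z₁ , x₁≡z₁ , x~x₁ , z~z₁ with j⇒k x₁ z₁ x₁≡z₁
  ...   | x₂ , z₂ , x₂≡z₂ , x₁~x₂ , z₁~z₂ = x₂ , z₂ , x₂≡z₂ , x~x₁ ⨾ x₁~x₂ , z~z₁ ⨾ z₁~z₂

  Pump-≤ : ∀ {j k} → k ≤ j → Pump j k
  Pump-≤ k≤j x z x≡z = x , z , SameType-≤ k≤j x z x≡z , ≈-refl , ≈-refl

  -- Consequences of local testability; pumping of types.

  module _ (K : ℕ) (testable : KLocallyTestable (suc K) L) where

    EquivSuc⇒⇔ : EquivSuc K f g → L f ⇔ L g
    EquivSuc⇒⇔ {f} {g} (roots , nodes) =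
      mk⇔ (testable f g (roots , nodes)) (testable g f (swap roots , swap nodes))

    typeEqual⇒≈ : SameTypeSets K f g →
      Covers (suc K) (nodesF f) (nodesF e ++ nodesF g) →
      Covers (suc K) (nodesF g) (nodesF e ++ nodesF f) →
      f ≈[ e ] g
    typeEqual⇒≈ {f} {g} {e} f~g cov cov′ .inContext p = EquivSuc⇒⇔
      ( SameTypeSets-++ {f = e} K (Covers-⊆ K id , Covers-⊆ K id) (fill-SameTypeSets K p f~g)
      , nodes f~g cov , nodes (swap f~g) cov′ )
      where
      nodes : SameTypeSets K h h′ → Covers (suc K) (nodesF h) (nodesF e ++ nodesF h′) →
        Covers (suc K) (nodesF (e ++ fill p h)) (nodesF (e ++ fill p h′))
      nodes {h} {h′} h~h′ c =
        subst₂ (Covers (suc K)) (sym (nodesF-++ e (fill p h))) (sym (nodesF-++ e (fill p h′)))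
          (Covers-++ {f = nodesF e} (suc K) (Covers-⊆ (suc K) ∈-++⁺ˡ) (fill-Covers K (nodesF e) p h~h′ c))

    -- Local testability ignores order and multiplicity of siblings. This is the source of
    -- commutativity and idempotence of `++`.
    setEqual⇒≈ : f ⊆ g → g ⊆ f → f ≈[ e ] g
    setEqual⇒≈ {e = e} f⊆g g⊆f = typeEqual⇒≈ (Covers-⊆ K f⊆g , Covers-⊆ K g⊆f)
      (Covers-⊆ (suc K) (∈-++⁺ʳ (nodesF e) ∘ nodesF-mono f⊆g))
      (Covers-⊆ (suc K) (∈-++⁺ʳ (nodesF e) ∘ nodesF-mono g⊆f))

    ++-comm-≈ : ∀ f g → f ++ g ≈[ e ] g ++ f
    ++-comm-≈ f g = setEqual⇒≈ (++-least (xs⊆ys++xs f g) (xs⊆xs++ys g f))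
                               (++-least (xs⊆ys++xs g f) (xs⊆xs++ys f g))

    ++-cong-~ : f ~ f′ → g ~ g′ → f ++ g ~ f′ ++ g′
    ++-cong-~ {f} {f′} {g} {g′} f~f′ g~g′ =
      ≈-++ f g~g′ ⨾ ++-comm-≈ f g′ ⨾ ≈-++ g′ f~f′ ⨾ ++-comm-≈ g′ f′

    ~⇒env : e ~ e′ → ∀ h → L (e ++ h) ⇔ L (e′ ++ h)
    ~⇒env {e} {e′} e~e′ h = inContext (++-cong-~ e~e′ (≈-refl {h})) hole

    -- Duplicate `x`, turn the copy into `x` and `y`, then drop the extra `x`.
    insert : ∀ {d x y} → x ∈ d → [ x ] ≈[ e ] x ∷ y ∷ [] → d ≈[ e ] y ∷ d
    insert {d = d} {x} {y} x∈d x≈x+y =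
      setEqual⇒≈ ∈-++⁺ˡ (++-least id (∈-∷⁺ʳ x∈d λ ()))
      ⨾ ≈-++ d x≈x+y
      ⨾ setEqual⇒≈ (++-least there (∈-∷⁺ʳ (there x∈d) (∈-∷⁺ʳ (here refl) λ ())))
                   (∈-∷⁺ʳ (∈-++⁺ʳ d (there (here refl))) ∈-++⁺ˡ)

    insertAll : ∀ {c d} → All (λ y → ∃ λ x → x ∈ d × ([ x ] ≈[ e ] x ∷ y ∷ [])) c → d ≈[ e ] c ++ d
    insertAll [] = ≈-refl
    insertAll ((_ , x∈d , x≈x+y) ∷ c) = insert x∈d x≈x+y ⨾ ≈-++ [ _ ] (insertAll c)

    -- The hole of a context always comes last among its siblings, so `z` and its ancestors must be
    -- moved to the end; hence `~` and not equality.
    locate : ∀ e {z} → z ∈ nodesF e → ∃ λ q → e ~ fill q [ z ]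
    locate (node a g ∷ e) {z} z∈ with ∈-++⁻ (nodesT (node a g)) z∈
    ... | inj₁ (here refl) =
      addAll e hole ,
      subst (_ ~_) (sym (fill-addAll e hole [ z ])) (++-comm-≈ [ z ] e)
    ... | inj₁ (there z∈g) with locate g z∈g
    ...   | q , g~ =
      addAll e (wrap a q) ,
      subst (_ ~_) (sym (fill-addAll e (wrap a q) [ z ]))
        (++-comm-≈ [ node a g ] e ⨾ ≈-++ e (≈-fill (wrap a hole) g~))
    locate (t ∷ e) z∈ | inj₂ z∈e with locate e z∈e
    ... | q , e~ = add t q , ≈-++ [ t ] e~

    -- Pair every tree of f with one of g of the same type; in g the partners are
    -- redundant copies.
    Pump-Covers : ∀ {j k} → Pump j k → ∀ f g → Covers j f g →
      ∃₂ λ f′ g′ → SameTypeSets k f′ g′ × (f ~ f′) × (g ~ g′ ++ g)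
    Pump-Covers pump []      g cov = [] , [] , ((λ _ ()) , (λ _ ())) , ≈-refl , ≈-refl
    Pump-Covers {k = k} pump (t ∷ f) g cov
      with find (cov t (here refl)) | Pump-Covers pump f g (λ s → cov s ∘ there)
    ... | u , u∈g , t≡u | f′ , g′ , f′≡g′ , f~f′ , g~g′+g with pump t u t≡u
    ...   | t′ , u′ , t′≡u′ , t~t′ , u~u′ =
      t′ ∷ f′ , u′ ∷ g′ ,
      SameTypeSets-++ k (SameTypeSets-[] k t′ u′ t′≡u′) f′≡g′ ,
      ++-cong-~ t~t′ f~f′ ,
      (setEqual⇒≈ there (∈-∷⁺ʳ u∈g id) ⨾ ++-cong-~ u~u′ g~g′+g)

    -- The children are paired in both directions: `f₁` replaces `f` while its partner `g₁` joins
    -- `g`, and `g₂` replaces `g` while its partner `f₂` joins `f`. Both nodes then have matched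
    -- children.
    Pump-suc : ∀ {j k} → Pump j k → Pump (suc j) (suc k)
    Pump-suc {k = k} pump (node a f) (node .a g) (refl , cov , cov′)
      with Pump-Covers pump f g cov | Pump-Covers pump g f cov′
    ... | f₁ , g₁ , f₁≡g₁ , f~f₁ , g~g₁+g | g₂ , f₂ , g₂≡f₂ , g~g₂ , f~f₂+f =
      node a (f₂ ++ f₁) , node a (g₂ ++ g₁) ,
      (refl , SameTypeSets-++ k (swap g₂≡f₂) f₁≡g₁) ,
      ≈-fill (wrap a hole) (f~f₂+f ⨾ ≈-++ f₂ f~f₁) ,
      ≈-fill (wrap a hole) (g~g₁+g ⨾ ≈-++ g₁ g~g₂ ⨾ ++-comm-≈ g₁ g₂)

    -- Why a repetition makes the chain constant: `Pump-suc` shifts the climb from `k` to `j + k` up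
    -- by one, and the given step goes in front.
    Pump-+ : ∀ {k} j → Pump k (suc k) → Pump k (j + k)
    Pump-+ zero    pump = Pump-≤ ≤-refl
    Pump-+ (suc j) pump = Pump-trans pump (Pump-suc (Pump-+ j pump))

    -- Copying and absorption.

    module _ {N : ℕ} (pump : Pump N K) where

      -- After pumping, `z′` adds no root type beside `x′`, and all its nodes already occur in the
      -- environment `fill q [ z′ ]`.
      copy : ∀ x z → SameType N x z → z ∈ nodesF e → [ x ] ≈[ e ] x ∷ z ∷ []
      copy {e} x z x≡z z∈e with locate e z∈e | pump x z x≡z
      ... | q , e~ | x′ , z′ , x′≡z′ , x~x′ , z~z′ =
        ≈-env (~⇒env (e~ ⨾ ≈-fill q z~z′))
          (~⇒≈ x~x′ ⨾ x′≈x′+z′ ⨾ ~⇒≈ (≈-sym (++-cong-~ x~x′ z~z′)))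
        where
        x′≈x′+z′ : [ x′ ] ≈[ fill q [ z′ ] ] x′ ∷ z′ ∷ []
        x′≈x′+z′ = typeEqual⇒≈
          ( Covers-⊆ K (λ { (here refl) → here refl })
          , λ { _ (here refl)         → here (SameType-refl K x′)
              ; _ (there (here refl)) → here (SameType-sym K x′ z′ x′≡z′) } )
          (Covers-⊆ (suc K) (∈-++⁺ʳ (nodesF (fill q [ z′ ])) ∘ nodesF-mono {f = [ x′ ]} {x′ ∷ z′ ∷ []} ∈-++⁺ˡ))
          (Covers-⊆ (suc K)
            (++-least {xs = nodesT x′} {nodesT z′ ++ []}
              (∈-++⁺ʳ (nodesF (fill q [ z′ ])) ∘ ∈-++⁺ˡ)
              (∈-++⁺ˡ ∘ nodesF-⊆-fill {f = [ z′ ]} q)))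

      -- Duplicate `e` and rewrite only the second copy; the first one serves as the environment of
      -- the rewriting.
      enrich : ∀ q → e ~ fill q f → f ≈[ e ] f′ →
        ∀ h → L (e ++ h) ⇔ L ((fill q f′ ++ e) ++ h)
      enrich {e} {f} {f′} q e~ f≈f′ h =
        ⇔.trans (inContext duplicated hole)
          (⇔.trans (inContext (≈-++ h (≈-fill q f≈f′)) hole)
            (inContext (setEqual⇒≈ {e = []}
              (++-least (xs⊆xs++ys (fill q f′ ++ e) h ∘ xs⊆ys++xs e (fill q f′))
                (++-least (xs⊆ys++xs h (fill q f′ ++ e))
                  (xs⊆xs++ys (fill q f′ ++ e) h ∘ xs⊆xs++ys (fill q f′) e)))
              (++-least
                (++-least (∈-++⁺ʳ e ∘ xs⊆ys++xs (fill q f′) h) (xs⊆xs++ys e (h ++ fill q f′)))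
                (∈-++⁺ʳ e ∘ xs⊆xs++ys h (fill q f′)))) hole))
        where
        duplicated : e ++ h ~ e ++ h ++ fill q f
        duplicated =
          setEqual⇒≈ ∈-++⁺ˡ (++-least id (xs⊆xs++ys e h))
          ⨾ subst (λ u → (e ++ h) ++ e ~ u) (++-assoc e h (fill q f)) (≈-++ (e ++ h) e~)

      absorb : ∀ e x y → Covers (suc N) (nodesT y) (nodesF e) → SameType N x y →
        [ x ] ≈[ e ] x ∷ y ∷ []
      -- The recursion descends in `c` alone: `d` is chosen afresh from the nodes of `e` at each
      -- level, so it is arbitrary.
      absorbAll : ∀ e d c → Covers (suc N) (nodesF c) (nodesF e) → Covers N c d →
        All (λ y → ∃ λ x → x ∈ d × ([ x ] ≈[ e ] x ∷ y ∷ [])) c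

      absorb e x y@(node a c) cov x≡y with find (cov y (here refl))
      -- Agreement to depth `suc N` gives agreement of `c` and `d` to depth `N`, as the recursive
      -- call and `copy` require.
      ... | node .a d , z∈e , y≡z@(refl , c⊆d , d⊆c) with locate e z∈e
      ...   | q , e~ =
        ≈-env (enrich q e~ (≈-fill (wrap a hole) d≈c+d))
          (copy x z′ x≡z′ (∈-nodes z′∈) ⨾ ≈-++ [ x ] (≈-fill (wrap a hole) (≈-sym c≈c+d)))
        where
        z′ = node a (c ++ d)
        e⁺ = fill q [ z′ ] ++ e

        d≈c+d : d ≈[ e ] c ++ d
        d≈c+d = insertAll (absorbAll e d c (λ t → cov t ∘ there) c⊆d)

        z′∈ : z′ ∈ nodesF (fill q [ z′ ])
        z′∈ = nodesF-⊆-fill {f = [ z′ ]} q (here refl)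

        ∈-nodes : nodesF (fill q [ z′ ]) ⊆ nodesF e⁺
        ∈-nodes = nodesF-mono {f = fill q [ z′ ]} ∈-++⁺ˡ

        x≡z′ : SameType N x z′
        x≡z′ = SameType-trans N x y z′ x≡y (SameType-pred N y z′
          (refl , Covers-⊆ N ∈-++⁺ˡ , Covers-++ N (Covers-⊆ N id) d⊆c))

        -- Each tree of `d` occurs in `e⁺` as a child of `z′` and has a partner of the same `N`-type
        -- in `c`, so it can be copied.
        c≈c+d : c ≈[ e⁺ ] c ++ d
        c≈c+d = insertAll (All.tabulate partner) ⨾ ++-comm-≈ d c
          where
          partner : ∀ {u} → u ∈ d → ∃ λ t → t ∈ c × ([ t ] ≈[ e⁺ ] t ∷ u ∷ [])
          partner {u} u∈d with find (d⊆c u u∈d)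
          ... | t , t∈c , u≡t =
            t , t∈c , copy t u (SameType-sym N u t u≡t)
              (∈-nodes (nodesF-children (fill q [ z′ ]) z′∈ (∈-++⁺ʳ c u∈d)))

      absorbAll e d []      cov c⊆d = []
      absorbAll e d (y ∷ c) cov c⊆d with find (c⊆d y (here refl))
      ... | x , x∈d , y≡x =
        (x , x∈d , absorb e x y (λ t → cov t ∘ ∈-++⁺ˡ) (SameType-sym N y x y≡x))
        ∷ absorbAll e d c (λ t → cov t ∘ ∈-++⁺ʳ (nodesT y)) (λ t → c⊆d t ∘ there)

      -- Of two copies of `s`, one is the environment and the other absorbs `t`.
      ⇔-++ : ∀ s t → Covers N t s → Covers (suc N) (nodesF t) (nodesF s) → L s ⇔ L (s ++ t)
      ⇔-++ s t roots nodes =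
        ⇔.trans (inContext (setEqual⇒≈ {e = []} ∈-++⁺ˡ (++-least {xs = s} id id)) hole)
          (⇔.trans (inContext (insertAll (absorbAll s s t nodes roots)) hole)
            (inContext (setEqual⇒≈ {e = []}
              (++-least (xs⊆xs++ys s t) (++-least (xs⊆ys++xs t s) (xs⊆xs++ys s t)))
              (++-least (xs⊆xs++ys s (t ++ s)) (∈-++⁺ʳ s ∘ xs⊆xs++ys t s))) hole))

      EquivSuc⇒~ : EquivSuc N f g → f ~ g
      EquivSuc⇒~ {f} {g} (roots , nodes) .inContext p =
        ⇔.trans (⇔-++ (fill p f) (fill p g) (proj₂ roots′) (fill-Covers N [] p (swap roots) (proj₂ nodes)))
          (⇔.trans (inContext (++-comm-≈ {e = []} (fill p f) (fill p g)) hole)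
            (⇔.sym (⇔-++ (fill p g) (fill p f) (proj₁ roots′) (fill-Covers N [] p roots (proj₁ nodes)))))
        where
        roots′ = fill-SameTypeSets N p roots

    -- Counting pairs of syntactic values.

    module _ (n : ℕ) (index : Forest A → Fin n)
             (index-injective : ∀ {f g} → index f ≡ index g → f ~ g) where

      -- Coding pairs of classes in `Fin (n * n)` makes these sets a chain in a finite set; the
      -- bound originates here.
      Realised : ℕ → Fin (n * n) → Set
      Realised k c = ∃₂ λ x z → SameType k x z × combine (index [ x ]) (index [ z ]) ≡ c

      Realised-≤ : ∀ {j k} → j ≤ k → ∀ {c} → Realised k c → Realised j c
      Realised-≤ j≤k (x , z , x≡z , eq) = x , z , SameType-≤ j≤k x z x≡z , eq

      Realised⇒Pump : ∀ {j k} → (∀ c → Realised j c → Realised k c) → Pump j k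
      Realised⇒Pump j⇒k x z x≡z with j⇒k _ (x , z , x≡z , refl)
      ... | x′ , z′ , x′≡z′ , eq with combine-injective _ _ _ _ eq
      ...   | eqˣ , eqᶻ = x′ , z′ , x′≡z′ , index-injective (sym eqˣ) , index-injective (sym eqᶻ)

      ¬¬Pump : ¬ ¬ Pump (n * n) K
      ¬¬Pump = ¬¬-map fromStable (antitone-chain-stabilises (n * n) Realised Realised-≤)
        where
        fromStable : (∃ λ k → k ≤ n * n × (∀ c → Realised k c → Realised (suc k) c)) →
          Pump (n * n) K
        fromStable (k , k≤ , stable) =
          -- Weaken from `n * n` to the stable depth `k`, climb to `K + k`, and weaken to `K`; this
          -- avoids comparing `k` with `K`.
          Pump-trans (Pump-≤ k≤) (Pump-trans (Pump-+ K (Realised⇒Pump stable)) (Pump-≤ (m≤m+n K k)))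

-- The bound on local testability.

theorem7 : (A : Set) → Finite A → (L : Forest A → Set) → Regular L →
    (n : ℕ) → SyntacticHSize L n →
    LocallyTestable L → KLocallyTestable (suc (n * n)) L
theorem7 A _ L _ n (rep , rep-injective , classify) (suc K , testable) s t s≡t =
  Equivalence.to (index-injective index≡ hole)
  where
  index : Forest A → Fin n
  index f = proj₁ (classify f)

  index-injective : ∀ {f g} → index f ≡ index g → SynEq L f g
  index-injective {f} {g} eq p =
    ⇔.trans (subst (λ i → L (fill p f) ⇔ L (fill p (rep i))) eq (proj₂ (classify f) p))
      (⇔.sym (proj₂ (classify g) p))

  index-cong : ∀ {f g} → SynEq L f g → index f ≡ index g
  index-cong {f} {g} f~g = rep-injective _ _ λ p →
    ⇔.trans (⇔.sym (proj₂ (classify f) p)) (⇔.trans (f~g p) (proj₂ (classify g) p))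

  -- Equality of indices is decidable, so that pumping is only needed up to double negation.
  index≡ : index s ≡ index t
  index≡ = decidable-stable (index s ≟ᶠ index t)
    (¬¬-map (λ pump → index-cong (_≈[_]_.inContext (EquivSuc⇒~ L K testable pump s≡t)))
      (¬¬Pump L K testable n index (interchangeable ∘ index-injective)))
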